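{- Let $q$ be a prime power with $q\equiv 3\pmod 4$, let $s\in\mathbb{N}$ be even, let $b\in\mathbb{F}_q^*$, and let $f(x)=x^s\left(x^{(q-1)/2}+b\right)\in\mathbb{F}_q[x]$. If $f$ is a permutation polynomial of $\mathbb{F}_q$, then $\delta_f\le 4s-3$.
   Context: A polynomial $f\in\mathbb{F}_q[x]$ is a permutation polynomial of $\mathbb{F}_q$ if $c\mapsto f(c)$ is a bijection of $\mathbb{F}_q$. For $a\in\mathbb{F}_q^*$, $\Delta_{f,a}(x)=f(x+a)-f(x)$, and the differential uniformity is $\delta_f=\max_{a\in\mathbb{F}_q^*,\,c\in\mathbb{F}_q}|\{x\in\mathbb{F}_q:\Delta_{f,a}(x)=c\}|$. -}

module Defs where

open import Algebra.Bundles using (CommutativeRing)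
open import Data.Fin.Base using (Fin)
open import Data.Fin.Properties using (inj⇒≟)
open import Data.List.Base using (List; []; _∷_; map; filter; length; allFin; cartesianProductWith)
open import Data.List.Extrema.Nat using (max)
open import Data.Nat.Base using (ℕ; zero; suc; _≤_; _^_)
open import Data.Nat.Primality using (Prime)
open import Data.Product.Base using (∃-syntax; _×_)
open import Function.Bundles using (Inverse)
open import Function.Definitions using (Bijective)
open import Function.Properties.Inverse using (Inverse⇒Injection) renaming (sym to inverse-sym)
open import Level using (Level; _⊔_) renaming (suc to lsuc)
open import Relation.Binary.Definitions using (Decidable)
open import Relation.Binary.PropositionalEquality using (_≡_; setoid)
open import Relation.Nullary.Decidable.Core using (¬?)
open import Relation.Nullary.Negation.Core using (¬_)

IsPrimePower : ℕ → Set
IsPrimePower q = ∃[ p ] ∃[ k ] (Prime p × 1 ≤ k × q ≡ p ^ k)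

record FiniteField (c ℓ : Level) (q : ℕ) : Set (lsuc (c ⊔ ℓ)) where
  field
    commutativeRing : CommutativeRing c ℓ

  open CommutativeRing commutativeRing public renaming (setoid to carrierSetoid)

  field
    1≉0         : ¬ (1# ≈ 0#)
    invertible  : ∀ x → ¬ (x ≈ 0#) → ∃[ y ] (x * y ≈ 1#)
    enumeration : Inverse (setoid (Fin q)) carrierSetoid

module _ {c ℓ : Level} {q : ℕ} (F : FiniteField c ℓ q) where
  open FiniteField F

  infix 4 _≟_
  _≟_ : Decidable _≈_
  _≟_ = inj⇒≟ (Inverse⇒Injection (inverse-sym enumeration))

  elements : List Carrier
  elements = map (Inverse.to enumeration) (allFin q)

  nonzeroElements : List Carrier
  nonzeroElements = filter (λ a → ¬? (a ≟ 0#)) elements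

  -- Coefficient lists, constant term first; trailing zeros are allowed, so a
  -- polynomial has many representatives.
  Poly : Set c
  Poly = List Carrier

  constant : Carrier → Poly
  constant a = a ∷ []

  X : Poly
  X = 0# ∷ 1# ∷ []

  addᴾ : Poly → Poly → Poly
  addᴾ []      g       = g
  addᴾ (a ∷ f) []      = a ∷ f
  addᴾ (a ∷ f) (b ∷ g) = (a + b) ∷ addᴾ f g

  mulᴾ : Poly → Poly → Poly
  mulᴾ []      g = []
  mulᴾ (a ∷ f) g = addᴾ (map (a *_) g) (0# ∷ mulᴾ f g)

  powᴾ : Poly → ℕ → Poly
  powᴾ f zero    = constant 1#
  powᴾ f (suc n) = mulᴾ f (powᴾ f n)

  eval : Poly → Carrier → Carrier
  eval []      x = 0#
  eval (a ∷ f) x = a + x * eval f x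

  IsPermutationPolynomial : Poly → Set (c ⊔ ℓ)
  IsPermutationPolynomial f = Bijective _≈_ _≈_ (eval f)

  Δ : Poly → Carrier → Carrier → Carrier
  Δ f a x = eval f (x + a) - eval f x

  solutionCount : Poly → Carrier → Carrier → ℕ
  solutionCount f a d = length (filter (λ x → Δ f a x ≟ d) elements)

  -- The leading 0 is only the value of max on an empty list; the list here is
  -- never empty, as 1≉0.
  differentialUniformity : Poly → ℕ
  differentialUniformity f =
    max 0 (cartesianProductWith (solutionCount f) nonzeroElements elements)

{-# OPTIONS --safe #-}
module Submission where

open import Defs
open import Data.Nat.Base using (ℕ; _≤_; _∸_; _/_; _%_)
open import Data.Nat.Divisibility using (_∣_; divides)
open import Data.Nat.DivMod using (m≡m%n+[m/n]*n; m*n/n≡m)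
open import Level using (Level)
open import Relation.Binary.PropositionalEquality using (_≡_)
open import Relation.Nullary.Negation.Core using (¬_)

open import Data.Empty using (⊥-elim)
open import Data.Fin.Base as Fin using (Fin; punchIn)
open import Data.Fin.Properties using (punchInᵢ≢i)
open import Data.Fin.Permutation using (permutation)
open import Data.List.Base using (List; []; _∷_; map; filter; length; foldr; allFin)
open import Data.List.Extrema.Nat using (max≤v⁺)
open import Data.List.Membership.Propositional.Properties using (∈-filter⁻)
open import Data.List.Properties using (length-map; length-tabulate)
open import Data.List.Relation.Unary.All as All using (All; []; _∷_)
open import Data.List.Relation.Unary.All.Properties using (¬Any⇒All¬; all-filter; cartesianProductWith⁺; filter⁺)
open import Data.List.Relation.Unary.AllPairs using ([]; _∷_)
open import Data.List.Relation.Unary.Any using (Any; here; there)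
open import Data.Nat.Base using (zero; suc; _<_; z≤n; s≤s)
import Data.Nat.Base as ℕ
import Data.Nat.Properties as ℕ
open import Data.Product.Base using (∃-syntax; _×_; _,_; proj₁; proj₂)
open import Data.Sum.Base using (_⊎_; inj₁; inj₂; [_,_]′)
open import Data.Vec.Functional using (removeAt; replicate)
open import Function.Base using (_∘_)
open import Function.Bundles using (Inverse; Injection)
open import Function.Properties.Inverse using (Inverse⇒Injection)
open import Level using (_⊔_)
open import Relation.Binary.PropositionalEquality as ≡ using ()
open import Relation.Nullary.Decidable.Core using (yes; no; ¬?; _⊎-dec_)
open import Relation.Nullary.Negation.Core using (contradiction)
open import Relation.Unary using (Pred; Decidable; _∪_; _∩_)

-- Write m = (q - 1)/2, which is odd, and χ x = xᵐ, so χ (-1) = -1. For given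
-- signs ε = χ (x + a), η = χ x, the solutions of f (x + a) - f x = d are roots of
--   R ε η x = (ε + b)(x + a)ˢ - (η + b)xˢ - d,
-- whose degree is s, or at most s - 1 when ε = η. It does not vanish identically,
-- as R ε η 0 - R ε η (-a) = (ε + η + 2b)aˢ, and a permutation polynomial has
-- b ≠ ±1. This allows (s - 1) + (s - 1) + s + s = 4s - 2 solutions. A solution
-- x = 0 or x = -a is a root of two of the four polynomials, which saves one.
-- Otherwise equality would make R 1 1, R 1 (-1) and R (-1) 1 split completely with
-- roots in their sign classes, and comparing χ at 0 and at -a gives χ 2 = -χ 2.

-- Counting a list covered by two overlapping predicates.

module Counting {a p r} {A : Set a} {P : Pred A p} {R : Pred A r}
                (P? : Decidable P) (R? : Decidable R) where

  length-cover : ∀ {xs} → All (P ∪ R) xs →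
                 length xs ≤ length (filter P? xs) ℕ.+ length (filter R? xs)
  length-cover [] = z≤n
  length-cover {x ∷ xs} (c ∷ cs) with P? x | R? x
  ... | yes _ | yes _ = s≤s (ℕ.≤-trans (length-cover cs) (ℕ.+-monoʳ-≤ _ (ℕ.n≤1+n _)))
  ... | yes _ | no _  = s≤s (length-cover cs)
  ... | no _  | yes _ = ℕ.≤-trans (s≤s (length-cover cs)) (ℕ.≤-reflexive (≡.sym (ℕ.+-suc _ _)))
  ... | no ¬p | no ¬r = ⊥-elim ([ ¬p , ¬r ]′ c)

  -- An element satisfying both predicates is counted by both filters, which makes the covering
  -- inequality strict.
  length-overlap : ∀ {xs} → All (P ∪ R) xs → Any (P ∩ R) xs →
                   length xs < length (filter P? xs) ℕ.+ length (filter R? xs)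
  length-overlap {x ∷ xs} (_ ∷ cs) (here (p , r)) with P? x | R? x
  ... | yes _ | yes _ = s≤s (ℕ.≤-trans (s≤s (length-cover cs)) (ℕ.≤-reflexive (≡.sym (ℕ.+-suc _ _))))
  ... | no ¬p | _     = contradiction p ¬p
  ... | yes _ | no ¬r = contradiction r ¬r
  length-overlap {x ∷ xs} (c ∷ cs) (there o) with P? x | R? x
  ... | yes _ | yes _ = s≤s (ℕ.≤-trans (length-overlap cs o) (ℕ.+-monoʳ-≤ _ (ℕ.n≤1+n _)))
  ... | yes _ | no _  = s≤s (length-overlap cs o)
  ... | no _  | yes _ = ℕ.≤-trans (s≤s (length-overlap cs o)) (ℕ.≤-reflexive (≡.sym (ℕ.+-suc _ _)))
  ... | no ¬p | no ¬r = ⊥-elim ([ ¬p , ¬r ]′ c)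

  -- Any overlap would cost one in the count. This is how equality excludes the elements
  -- deliberately counted twice.
  tight-cover : ∀ {xs} → All (P ∪ R) xs →
                length (filter P? xs) ℕ.+ length (filter R? xs) ≤ length xs →
                All (λ x → ¬ (P x × R x)) xs
  tight-cover cs tight = ¬Any⇒All¬ _ (λ o → ℕ.<⇒≱ (length-overlap cs o) tight)

open Counting

-- Slack in either summand would leave slack in the sum. This passes equality from a total count
-- down to its parts.
+-tightˡ : ∀ {i j k l} → i ≤ k → j ≤ l → k ℕ.+ l ≤ i ℕ.+ j → i ≡ k
+-tightˡ {i} {j} {k} {l} i≤k j≤l tight =
  ℕ.≤-antisym i≤k (ℕ.+-cancelʳ-≤ l k i (ℕ.≤-trans tight (ℕ.+-monoʳ-≤ i j≤l)))

+-tightʳ : ∀ {i j k l} → i ≤ k → j ≤ l → k ℕ.+ l ≤ i ℕ.+ j → j ≡ l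
+-tightʳ {i} {j} {k} {l} i≤k j≤l tight =
  ℕ.≤-antisym j≤l (ℕ.+-cancelˡ-≤ k l j (ℕ.≤-trans tight (ℕ.+-monoˡ-≤ j i≤k)))

-- Absence of zero divisors, powers and signs.

module FieldTheory {c ℓ : Level} {q : ℕ} (F : FiniteField c ℓ q) where
  open FiniteField F public hiding (zero)
  open import Algebra.Properties.CommutativeSemiring.Exp commutativeSemiring public
  open import Algebra.Properties.Ring ring public
    using (-‿distribˡ-*; -‿distribʳ-*; -‿involutive; -1*x≈-x; -0#≈0#; -‿+-comm;
           x∙y⁻¹≈ε⇒x≈y; x≈y⇒x∙y⁻¹≈ε)
  open import Algebra.Solver.Ring.NaturalCoefficients.Default commutativeSemiring public
    using (solve; _:=_; _:+_; _:*_)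
  open import Data.List.Relation.Unary.Unique.Setoid carrierSetoid public using (Unique)
  open import Relation.Binary.Reasoning.Setoid carrierSetoid

  x*y≈0⇒x≈0⊎y≈0 : ∀ {x y} → x * y ≈ 0# → x ≈ 0# ⊎ y ≈ 0#
  x*y≈0⇒x≈0⊎y≈0 {x} {y} xy≈0 with _≟_ F x 0#
  ... | yes x≈0 = inj₁ x≈0
  ... | no x≉0 with invertible x x≉0
  ...   | z , xz≈1 = inj₂ (begin
    y              ≈⟨ *-identityˡ y ⟨
    1# * y         ≈⟨ *-congʳ xz≈1 ⟨
    x * z * y      ≈⟨ solve 3 (λ x y z → x :* z :* y := z :* (x :* y)) refl x y z ⟩
    z * (x * y)    ≈⟨ *-congˡ xy≈0 ⟩
    z * 0#         ≈⟨ zeroʳ z ⟩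
    0#             ∎)

  x*y≉0 : ∀ {x y} → x ≉ 0# → y ≉ 0# → x * y ≉ 0#
  x*y≉0 x≉0 y≉0 xy≈0 = [ x≉0 , y≉0 ]′ (x*y≈0⇒x≈0⊎y≈0 xy≈0)

  x^n≉0 : ∀ {x} n → x ≉ 0# → x ^ n ≉ 0#
  x^n≉0 zero    x≉0 = 1≉0
  x^n≉0 (suc n) x≉0 = x*y≉0 x≉0 (x^n≉0 n x≉0)

  1^n≈1 : ∀ n → 1# ^ n ≈ 1#
  1^n≈1 zero    = refl
  1^n≈1 (suc n) = trans (*-identityˡ _) (1^n≈1 n)

  [-x]*[-y]≈x*y : ∀ x y → - x * - y ≈ x * y
  [-x]*[-y]≈x*y x y = begin
    - x * - y     ≈⟨ -‿distribˡ-* x (- y) ⟨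
    - (x * - y)   ≈⟨ -‿cong (-‿distribʳ-* x y) ⟨
    - - (x * y)   ≈⟨ -‿involutive _ ⟩
    x * y         ∎

  [-x]^2n≈x^2n : ∀ x n → (- x) ^ (n ℕ.* 2) ≈ x ^ (n ℕ.* 2)
  [-x]^2n≈x^2n x zero    = refl
  [-x]^2n≈x^2n x (suc n) = begin
    - x * (- x * (- x) ^ (n ℕ.* 2))   ≈⟨ *-assoc _ _ _ ⟨
    - x * - x * (- x) ^ (n ℕ.* 2)     ≈⟨ *-cong ([-x]*[-y]≈x*y x x) ([-x]^2n≈x^2n x n) ⟩
    x * x * x ^ (n ℕ.* 2)             ≈⟨ *-assoc _ _ _ ⟩
    x * (x * x ^ (n ℕ.* 2))           ∎

  elements-unique : Unique (elements F)
  elements-unique = map⁺ (≡.setoid (Fin q)) carrierSetoid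
    (Injection.injective (Inverse⇒Injection enumeration)) (allFin⁺ q)
    where
    open import Data.List.Relation.Unary.Unique.Setoid.Properties using (map⁺)
    open import Data.List.Relation.Unary.Unique.Propositional.Properties using (allFin⁺)

  length-elements : length (elements F) ≡ q
  length-elements = ≡.trans (length-map _ (allFin q)) (length-tabulate {n = q} (λ i → i))

  -- Evaluation of coefficient lists as a homomorphism.

  eval-addᴾ : ∀ f g x → eval F (addᴾ F f g) x ≈ eval F f x + eval F g x
  eval-addᴾ []      g       x = sym (+-identityˡ _)
  eval-addᴾ (a ∷ f) []      x = sym (+-identityʳ _)
  eval-addᴾ (a ∷ f) (b ∷ g) x = begin
    a + b + x * eval F (addᴾ F f g) x         ≈⟨ +-congˡ (*-congˡ (eval-addᴾ f g x)) ⟩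
    a + b + x * (eval F f x + eval F g x)
      ≈⟨ solve 5 (λ a b x u v → a :+ b :+ x :* (u :+ v) := a :+ x :* u :+ (b :+ x :* v)) refl a b x _ _ ⟩
    a + x * eval F f x + (b + x * eval F g x) ∎

  eval-scale : ∀ a g x → eval F (map (a *_) g) x ≈ a * eval F g x
  eval-scale a []      x = sym (zeroʳ a)
  eval-scale a (b ∷ g) x = begin
    a * b + x * eval F (map (a *_) g) x ≈⟨ +-congˡ (*-congˡ (eval-scale a g x)) ⟩
    a * b + x * (a * eval F g x)        ≈⟨ solve 4 (λ a b x u → a :* b :+ x :* (a :* u) := a :* (b :+ x :* u)) refl a b x _ ⟩
    a * (b + x * eval F g x)            ∎

  eval-mulᴾ : ∀ f g x → eval F (mulᴾ F f g) x ≈ eval F f x * eval F g x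
  eval-mulᴾ []      g x = sym (zeroˡ _)
  eval-mulᴾ (a ∷ f) g x = begin
    eval F (addᴾ F (map (a *_) g) (0# ∷ mulᴾ F f g)) x
      ≈⟨ eval-addᴾ (map (a *_) g) _ x ⟩
    eval F (map (a *_) g) x + (0# + x * eval F (mulᴾ F f g) x)
      ≈⟨ +-cong (eval-scale a g x) (trans (+-identityˡ _) (*-congˡ (eval-mulᴾ f g x))) ⟩
    a * eval F g x + x * (eval F f x * eval F g x)
      ≈⟨ solve 4 (λ a x u v → a :* v :+ x :* (u :* v) := (a :+ x :* u) :* v) refl a x _ _ ⟩
    (a + x * eval F f x) * eval F g x ∎

  eval-constant : ∀ a x → eval F (constant F a) x ≈ a
  eval-constant a x = trans (+-congˡ (zeroʳ x)) (+-identityʳ a)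

  eval-X : ∀ x → eval F (X F) x ≈ x
  eval-X x = begin
    0# + x * (1# + x * 0#) ≈⟨ +-identityˡ _ ⟩
    x * (1# + x * 0#)      ≈⟨ *-congˡ (eval-constant 1# x) ⟩
    x * 1#                 ≈⟨ *-identityʳ x ⟩
    x                      ∎

  eval-powᴾ-X : ∀ n x → eval F (powᴾ F (X F) n) x ≈ x ^ n
  eval-powᴾ-X zero    x = eval-constant 1# x
  eval-powᴾ-X (suc n) x = trans (eval-mulᴾ (X F) (powᴾ F (X F) n) x) (*-cong (eval-X x) (eval-powᴾ-X n x))

  -- IsPolynomial n L p: the function p is given by some polynomial of degree at
  -- most n whose coefficient of xⁿ is L (possibly zero).
  data IsPolynomial : ℕ → Carrier → (Carrier → Carrier) → Set (c ⊔ ℓ) where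
    const  : ∀ {L p} → (∀ x → p x ≈ L) → IsPolynomial 0 L p
    horner : ∀ {n L p r} a → (∀ x → p x ≈ a + x * r x) → IsPolynomial n L r → IsPolynomial (suc n) L p

  -- Closure properties of polynomial functions with a recorded top coefficient.

  polynomial-resp : ∀ {n L L′ p p′} → L ≈ L′ → (∀ x → p x ≈ p′ x) → IsPolynomial n L p → IsPolynomial n L′ p′
  polynomial-resp L≈ p≈ (const eq)      = const (λ x → trans (sym (p≈ x)) (trans (eq x) L≈))
  polynomial-resp L≈ p≈ (horner a eq h) =
    horner a (λ x → trans (sym (p≈ x)) (eq x)) (polynomial-resp L≈ (λ _ → refl) h)

  polynomial-+ : ∀ {n L M p r} → IsPolynomial n L p → IsPolynomial n M r → IsPolynomial n (L + M) (λ x → p x + r x)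
  polynomial-+ (const e) (const e′) = const (λ x → +-cong (e x) (e′ x))
  polynomial-+ (horner a e h) (horner a′ e′ h′) = horner (a + a′)
    (λ x → trans (+-cong (e x) (e′ x))
      (solve 5 (λ a b x u v → a :+ x :* u :+ (b :+ x :* v) := a :+ b :+ x :* (u :+ v)) refl a a′ x _ _))
    (polynomial-+ h h′)

  polynomial-scale : ∀ {n L p} k → IsPolynomial n L p → IsPolynomial n (k * L) (λ x → k * p x)
  polynomial-scale k (const e) = const (λ x → *-congˡ (e x))
  polynomial-scale k (horner a e h) = horner (k * a)
    (λ x → trans (*-congˡ (e x))
      (solve 4 (λ k a x u → k :* (a :+ x :* u) := k :* a :+ x :* (k :* u)) refl k a x _))
    (polynomial-scale k h)

  -- The degree bound is positive here: at degree 0 the constant d would change the top coefficient.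
  polynomial-shift : ∀ {n L p} d → IsPolynomial (suc n) L p → IsPolynomial (suc n) L (λ x → p x + d)
  polynomial-shift d (horner a e h) = horner (a + d)
    (λ x → trans (+-congʳ (e x))
      (solve 3 (λ a d u → a :+ u :+ d := a :+ d :+ u) refl a d _)) h

  polynomial-*[x+a] : ∀ {n L p} a → IsPolynomial n L p → IsPolynomial (suc n) L (λ x → (x + a) * p x)
  polynomial-*[x+a] {L = L} a (const e) = horner (a * L)
    (λ x → trans (*-congˡ (e x)) (solve 3 (λ a x L → (x :+ a) :* L := a :* L :+ x :* L) refl a x L))
    (const (λ _ → refl))
  polynomial-*[x+a] a (horner a₀ e h) = horner (a * a₀)
    (λ x → trans (*-congˡ (e x))
      -- The tail is multiplied by x + a, and the old constant term a₀ re-enters as a shift of the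
      -- new tail.
      (solve 4 (λ a a₀ x u → (x :+ a) :* (a₀ :+ x :* u) := a :* a₀ :+ x :* ((x :+ a) :* u :+ a₀)) refl a a₀ x _))
    (polynomial-shift a₀ (polynomial-*[x+a] a h))

  polynomial-[x+a]^ : ∀ a n → IsPolynomial n 1# (λ x → (x + a) ^ n)
  polynomial-[x+a]^ a zero    = const (λ _ → refl)
  polynomial-[x+a]^ a (suc n) = polynomial-*[x+a] a (polynomial-[x+a]^ a n)

  polynomial-x^ : ∀ n → IsPolynomial n 1# (_^ n)
  polynomial-x^ n = polynomial-resp refl (λ x → ^-congˡ n (+-identityʳ x)) (polynomial-[x+a]^ 0# n)

  -- Serves `R ε ε`, whose terms of degree s cancel. Nothing is recorded about the new top
  -- coefficient M beyond its existence.
  polynomial-drop : ∀ {n L p} → L ≈ 0# → IsPolynomial (suc n) L p → ∃[ M ] IsPolynomial n M p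
  polynomial-drop L≈0 (horner a e (const e′)) = a , const λ x → begin
    _             ≈⟨ e x ⟩
    a + x * _     ≈⟨ +-congˡ (*-congˡ (trans (e′ x) L≈0)) ⟩
    a + x * 0#    ≈⟨ eval-constant a x ⟩
    a             ∎
  polynomial-drop L≈0 (horner a e h@(horner _ _ _)) with polynomial-drop L≈0 h
  ... | M , h′ = M , horner a e h′

  -- Roots, division by linear factors and complete splitting.

  x-r≉0 : ∀ {x r} → r ≉ x → x - r ≉ 0#
  x-r≉0 r≉x = r≉x ∘ sym ∘ x∙y⁻¹≈ε⇒x≈y _ _

  x*t≈r*t+[x-r]*t : ∀ x r t → x * t ≈ r * t + (x - r) * t
  x*t≈r*t+[x-r]*t x r t = begin
    x * t                      ≈⟨ *-congʳ (+-identityʳ x) ⟨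
    (x + 0#) * t               ≈⟨ *-congʳ (+-congˡ (-‿inverseʳ r)) ⟨
    (x + (r - r)) * t
      ≈⟨ solve 4 (λ x r r⁻ t → (x :+ (r :+ r⁻)) :* t := r :* t :+ (x :+ r⁻) :* t) refl x r (- r) t ⟩
    r * t + (x - r) * t        ∎

  -- Synthetic division: if the Horner tail p′ has quotient d, then a + x p′ has quotient p′ r + x
  -- d. The top coefficient passes to the quotient unchanged.
  divide : ∀ {n L p} → IsPolynomial (suc n) L p → ∀ r →
           ∃[ d ] (IsPolynomial n L d × (∀ x → p x ≈ p r + (x - r) * d x))
  divide {L = L} {p} (horner a e (const e′)) r = (λ _ → L) , const (λ _ → refl) , λ x → begin
    p x                          ≈⟨ trans (e x) (+-congˡ (*-congˡ (e′ x))) ⟩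
    a + x * L                    ≈⟨ +-congˡ (x*t≈r*t+[x-r]*t x r L) ⟩
    a + (r * L + (x - r) * L)    ≈⟨ +-assoc _ _ _ ⟨
    a + r * L + (x - r) * L      ≈⟨ +-congʳ (trans (e r) (+-congˡ (*-congˡ (e′ r)))) ⟨
    p r + (x - r) * L            ∎
  divide {p = p} (horner {r = p′} a e h@(horner _ _ _)) r with divide h r
  ... | d , hd , eq = _ , horner (p′ r) (λ _ → refl) hd , λ x → begin
    p x
      ≈⟨ trans (e x) (+-congˡ (*-congˡ (eq x))) ⟩
    a + x * (p′ r + (x - r) * d x)
      ≈⟨ +-congˡ (distribˡ _ _ _) ⟩
    a + (x * p′ r + x * ((x - r) * d x))
      ≈⟨ +-congˡ (+-congʳ (x*t≈r*t+[x-r]*t x r (p′ r))) ⟩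
    a + (r * p′ r + (x - r) * p′ r + x * ((x - r) * d x))
      ≈⟨ solve 6 (λ a x r y t u → a :+ (r :* t :+ y :* t :+ x :* (y :* u)) := a :+ r :* t :+ y :* (t :+ x :* u))
               refl a x r (x - r) (p′ r) (d x) ⟩
    a + r * p′ r + (x - r) * (p′ r + x * d x)
      ≈⟨ +-congʳ (e r) ⟨
    p r + (x - r) * (p′ r + x * d x) ∎

  -- Each other root t has t - r nonzero, so without zero divisors it must be a root of the
  -- quotient.
  divide-root : ∀ {n L p r rs} → IsPolynomial (suc n) L p → p r ≈ 0# →
                All (r ≉_) rs → All (λ t → p t ≈ 0#) rs →
                ∃[ d ] (IsPolynomial n L d × (∀ x → p x ≈ (x - r) * d x) × All (λ t → d t ≈ 0#) rs)
  divide-root {p = p} {r} h pr≈0 r≉rs roots with divide h r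
  ... | d , hd , eq = d , hd , eq′ , All.zipWith other-root (r≉rs , roots)
    where
    eq′ = λ x → trans (eq x) (trans (+-congʳ pr≈0) (+-identityˡ _))
    other-root : ∀ {t} → r ≉ t × p t ≈ 0# → d t ≈ 0#
    other-root {t} (r≉t , pt≈0) =
      [ ⊥-elim ∘ x-r≉0 r≉t , (λ dt≈0 → dt≈0) ]′ (x*y≈0⇒x≈0⊎y≈0 (trans (sym (eq′ t)) pt≈0))

  -- Induction on the degree bound, dividing out one root at a time until a constant with a root
  -- remains. Vanishing of L contradicts a known top coefficient; vanishing of the function gives
  -- the root bound.
  too-many-roots : ∀ {n L p} → IsPolynomial n L p → ∀ {rs} → Unique rs →
                   All (λ t → p t ≈ 0#) rs → n < length rs → L ≈ 0# × (∀ x → p x ≈ 0#)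
  too-many-roots (const e) {r ∷ _} _ (pr≈0 ∷ _) _ = L≈0 , λ x → trans (e x) L≈0
    where L≈0 = trans (sym (e r)) pr≈0
  too-many-roots h@(horner _ _ _) {r ∷ rs} (r≉rs ∷ rs!) (pr≈0 ∷ roots) (s≤s n<)
    with divide-root h pr≈0 r≉rs roots
  ... | d , hd , eq , roots′ with too-many-roots hd rs! roots′ n<
  ...   | L≈0 , d≈0 = L≈0 , λ x → trans (eq x) (trans (*-congˡ (d≈0 x)) (zeroʳ _))

  -- Nonvanishing is asked of the function and not of L, so n may exceed the true degree.
  root-bound : ∀ {n L p} → IsPolynomial n L p → ¬ (∀ x → p x ≈ 0#) → ∀ {rs} → Unique rs →
               All (λ t → p t ≈ 0#) rs → length rs ≤ n
  root-bound h p≉0 rs! roots = ℕ.≮⇒≥ (p≉0 ∘ proj₂ ∘ too-many-roots h rs! roots)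

  ∏[_-_] : Carrier → List Carrier → Carrier
  ∏[ x - rs ] = foldr (λ r y → (x - r) * y) 1# rs

  -- Division preserves the top coefficient, so after all n roots are divided out the remaining
  -- constant is L.
  factorisation : ∀ {n L p} → IsPolynomial n L p → ∀ {rs} → Unique rs →
                  All (λ t → p t ≈ 0#) rs → length rs ≡ n → ∀ x → p x ≈ L * ∏[ x - rs ]
  factorisation (const e) {[]} _ _ _ x = trans (e x) (sym (*-identityʳ _))
  factorisation {L = L} {p} h@(horner _ _ _) {r ∷ rs} (r≉rs ∷ rs!) (pr≈0 ∷ roots) len x
    with divide-root h pr≈0 r≉rs roots
  ... | d , hd , eq , roots′ = begin
    p x                           ≈⟨ eq x ⟩
    (x - r) * d x                 ≈⟨ *-congˡ (factorisation hd rs! roots′ (ℕ.suc-injective len) x) ⟩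
    (x - r) * (L * ∏[ x - rs ])   ≈⟨ solve 3 (λ u L v → u :* (L :* v) := L :* (u :* v)) refl (x - r) L _ ⟩
    L * ((x - r) * ∏[ x - rs ])   ∎

-- Fermat's little theorem in a field with n + 1 elements.

module _ {c ℓ : Level} {n : ℕ} (F : FiniteField c ℓ (suc n)) where
  open FieldTheory F
  open import Algebra.Properties.CommutativeMonoid.Sum *-commutativeMonoid
    renaming (sum to ∏; sum-remove to ∏-remove; sum-permute to ∏-permute;
              ∑-distrib-+ to ∏-distrib-*; sum-cong-≋ to ∏-cong; sum-replicate to ∏-replicate)
    using ()
  open import Relation.Binary.Reasoning.Setoid carrierSetoid
  open Inverse enumeration using (to; from; from-cong; strictlyInverseˡ; strictlyInverseʳ)

  private
    -- With 0 replaced by 1, the product over the whole enumeration is the product of the nonzero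
    -- elements.
    replaceZero : Carrier → Carrier
    replaceZero x with _≟_ F x 0#
    ... | yes _ = 1#
    ... | no _  = x

    replaceZero-cong : ∀ {x y} → x ≈ y → replaceZero x ≈ replaceZero y
    replaceZero-cong {x} {y} x≈y with _≟_ F x 0# | _≟_ F y 0#
    ... | yes _   | yes _   = refl
    ... | no _    | no _    = x≈y
    ... | yes x≈0 | no y≉0  = contradiction (trans (sym x≈y) x≈0) y≉0
    ... | no x≉0  | yes y≈0 = contradiction (trans x≈y y≈0) x≉0

    replaceZero≉0 : ∀ x → replaceZero x ≉ 0#
    replaceZero≉0 x with _≟_ F x 0#
    ... | yes _   = 1≉0
    ... | no x≉0 = x≉0

    ∏≉0 : ∀ {k} (t : Fin k → Carrier) → (∀ i → t i ≉ 0#) → ∏ t ≉ 0#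
    ∏≉0 {zero}  t t≉0 = 1≉0
    ∏≉0 {suc k} t t≉0 = x*y≉0 (t≉0 Fin.zero) (∏≉0 (t ∘ Fin.suc) (t≉0 ∘ Fin.suc))

    -- The ratio between `replaceZero (a * x)` and `replaceZero x` for nonzero a.
    factor : Carrier → Carrier → Carrier
    factor a x with _≟_ F x 0#
    ... | yes _ = 1#
    ... | no _  = a

    factor-zero : ∀ a {x} → x ≈ 0# → factor a x ≈ 1#
    factor-zero a {x} x≈0 with _≟_ F x 0#
    ... | yes _  = refl
    ... | no x≉0 = contradiction x≈0 x≉0

    factor-nonzero : ∀ a {x} → x ≉ 0# → factor a x ≈ a
    factor-nonzero a {x} x≉0 with _≟_ F x 0#
    ... | yes x≈0 = contradiction x≈0 x≉0
    ... | no _    = refl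

    replaceZero-* : ∀ {a} x → a ≉ 0# → replaceZero (a * x) ≈ factor a x * replaceZero x
    replaceZero-* {a} x a≉0 with _≟_ F x 0# | _≟_ F (a * x) 0#
    ... | yes _   | yes _    = sym (*-identityˡ 1#)
    ... | yes x≈0 | no ax≉0  = contradiction (trans (*-congˡ x≈0) (zeroʳ a)) ax≉0
    ... | no x≉0  | yes ax≈0 = contradiction ax≈0 (x*y≉0 a≉0 x≉0)
    ... | no _    | no _     = refl

    -- Removing the index of 0, which contributes 1, leaves n indices that contribute a each.
    ∏-factor : ∀ a → ∏ (factor a ∘ to) ≈ a ^ n
    ∏-factor a = begin
      ∏ (factor a ∘ to)
        ≈⟨ ∏-remove {i = from 0#} (factor a ∘ to) ⟩
      factor a (to (from 0#)) * ∏ (removeAt (factor a ∘ to) (from 0#))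
        ≈⟨ *-cong (factor-zero a (strictlyInverseˡ 0#)) (∏-cong (λ i → factor-nonzero a (to≉0 i))) ⟩
      1# * ∏ (replicate n a)
        ≈⟨ *-identityˡ _ ⟩
      ∏ (replicate n a)
        ≈⟨ ∏-replicate n ⟩
      a ^ n ∎
      where
      to≉0 : ∀ i → to (punchIn (from 0#) i) ≉ 0#
      to≉0 i eq = punchInᵢ≢i (from 0#) i (≡.trans (≡.sym (strictlyInverseʳ _)) (from-cong eq))

  -- Multiplication by a permutes the nonzero elements, so it multiplies their
  -- product by aⁿ without changing it.
  fermat : ∀ {a} → a ≉ 0# → a ^ n ≈ 1#
  fermat {a} a≉0 with invertible a a≉0
  ... | a⁻¹ , a*a⁻¹≈1 = x∙y⁻¹≈ε⇒x≈y _ _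
    ([ (λ eq → eq) , ⊥-elim ∘ ∏≉0 _ (replaceZero≉0 ∘ to) ]′ (x*y≈0⇒x≈0⊎y≈0 (begin
      (a ^ n - 1#) * Π                  ≈⟨ distribʳ _ _ _ ⟩
      a ^ n * Π + - 1# * Π              ≈⟨ +-cong (sym Π≈aⁿΠ) (-1*x≈-x Π) ⟩
      Π - Π                             ≈⟨ -‿inverseʳ Π ⟩
      0#                                ∎)))
    where
    Π = ∏ (replaceZero ∘ to)
    scale : Carrier → Fin (suc n) → Fin (suc n)
    scale u i = from (u * to i)
    scale-inverse : ∀ {u v} → u * v ≈ 1# → ∀ i → scale u (scale v i) ≡ i
    scale-inverse {u} {v} uv≈1 i = ≡.trans (from-cong (begin
      u * to (from (v * to i))          ≈⟨ *-congˡ (strictlyInverseˡ _) ⟩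
      u * (v * to i)                    ≈⟨ *-assoc _ _ _ ⟨
      u * v * to i                      ≈⟨ *-congʳ uv≈1 ⟩
      1# * to i                         ≈⟨ *-identityˡ _ ⟩
      to i                              ∎)) (strictlyInverseʳ i)
    π = permutation (scale a) (scale a⁻¹)
      (scale-inverse a*a⁻¹≈1) (scale-inverse (trans (*-comm _ _) a*a⁻¹≈1))
    Π≈aⁿΠ : Π ≈ a ^ n * Π
    Π≈aⁿΠ = begin
      Π                                                  ≈⟨ ∏-permute (replaceZero ∘ to) π ⟩
      ∏ (replaceZero ∘ to ∘ scale a)                     ≈⟨ ∏-cong (λ i → replaceZero-cong (strictlyInverseˡ (a * to i))) ⟩
      ∏ (λ i → replaceZero (a * to i))                   ≈⟨ ∏-cong (λ i → replaceZero-* (to i) a≉0) ⟩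
      ∏ (λ i → factor a (to i) * replaceZero (to i))     ≈⟨ ∏-distrib-* (factor a ∘ to) (replaceZero ∘ to) ⟩
      ∏ (factor a ∘ to) * Π                              ≈⟨ *-congʳ (∏-factor a) ⟩
      a ^ n * Π                                          ∎

-- The quadratic character when (q - 1)/2 is odd.

module QuadraticCharacter {c ℓ : Level} {m j : ℕ} (m-odd : m ≡ suc (j ℕ.* 2))
                          (F : FiniteField c ℓ (suc (m ℕ.+ m))) where
  open FieldTheory F public
  open import Relation.Binary.Reasoning.Setoid carrierSetoid

  -- The quadratic character by Euler's criterion: the multiplicative group has order 2m.
  χ : Carrier → Carrier
  χ x = x ^ m

  χ-cong : ∀ {x y} → x ≈ y → χ x ≈ χ y
  χ-cong = ^-congˡ m

  χ-* : ∀ x y → χ (x * y) ≈ χ x * χ y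
  χ-* x y = ^-distrib-* x y m

  -- The even part of the exponent absorbs the sign and the one remaining factor keeps it. The
  -- oddness of m comes from q being 3 modulo 4.
  χ-neg : ∀ x → χ (- x) ≈ - χ x
  χ-neg x = begin
    (- x) ^ m                       ≡⟨ ≡.cong ((- x) ^_) m-odd ⟩
    - x * (- x) ^ (j ℕ.* 2)         ≈⟨ *-congˡ ([-x]^2n≈x^2n x j) ⟩
    - x * x ^ (j ℕ.* 2)             ≈⟨ -‿distribˡ-* _ _ ⟨
    - (x * x ^ (j ℕ.* 2))           ≡⟨ ≡.cong (λ k → - (x ^ k)) m-odd ⟨
    - χ x                           ∎

  -- By `fermat` the square of `χ x` is 1, so (χ x - 1)(χ x + 1) vanishes.
  χ≈±1 : ∀ {x} → x ≉ 0# → χ x ≈ 1# ⊎ χ x ≈ - 1#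
  χ≈±1 {x} x≉0 with x*y≈0⇒x≈0⊎y≈0 {χ x - 1#} {χ x - - 1#} (begin
    (χ x - 1#) * (χ x - - 1#)                  ≈⟨ *-congˡ (+-congˡ (-‿involutive 1#)) ⟩
    (χ x + - 1#) * (χ x + 1#)
      ≈⟨ solve 3 (λ y e o → (y :+ e) :* (y :+ o) := y :* y :+ y :* (o :+ e) :+ e :* o) refl (χ x) (- 1#) 1# ⟩
    χ x * χ x + χ x * (1# - 1#) + - 1# * 1#
      ≈⟨ +-cong (+-cong χ²≈1 (trans (*-congˡ (-‿inverseʳ 1#)) (zeroʳ _))) (*-identityʳ _) ⟩
    1# + 0# + - 1#                             ≈⟨ +-congʳ (+-identityʳ 1#) ⟩
    1# - 1#                                    ≈⟨ -‿inverseʳ 1# ⟩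
    0#                                         ∎)
    where χ²≈1 = trans (sym (^-homo-* x m m)) (fermat F x≉0)
  ... | inj₁ eq = inj₁ (x∙y⁻¹≈ε⇒x≈y _ _ eq)
  ... | inj₂ eq = inj₂ (x∙y⁻¹≈ε⇒x≈y _ _ eq)

  -- In characteristic 2 the polynomial x(xᵐ - 1) of degree m + 1 would vanish
  -- on all 2m + 1 elements.
  1+1≉0 : 1# + 1# ≉ 0#
  1+1≉0 2≈0 = 1≉0 (proj₁ (too-many-roots polynomial elements-unique
    (All.universal vanishes (elements F))
    (≡.subst (suc m <_) (≡.sym length-elements)
      (s≤s (≡.subst (λ k → k < k ℕ.+ k) (≡.sym m-odd) (ℕ.m<m+n _ (s≤s z≤n)))))))
    where
    polynomial : IsPolynomial (suc m) 1# (λ x → x * (χ x - 1#))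
    polynomial = horner 0# (λ _ → sym (+-identityˡ _))
      (≡.subst (λ k → IsPolynomial k 1# (λ x → x ^ k - 1#)) (≡.sym m-odd)
        (polynomial-shift (- 1#) (polynomial-x^ (suc (j ℕ.* 2)))))
    -1≈1 : - 1# ≈ 1#
    -1≈1 = sym (x∙y⁻¹≈ε⇒x≈y _ _ (trans (+-congˡ (-‿involutive 1#)) 2≈0))
    vanishes : ∀ x → x * (χ x - 1#) ≈ 0#
    vanishes x with _≟_ F x 0#
    ... | yes x≈0 = trans (*-congʳ x≈0) (zeroˡ _)
    ... | no x≉0  = trans (*-congˡ (x≈y⇒x∙y⁻¹≈ε ([ (λ eq → eq) , (λ eq → trans eq -1≈1) ]′ (χ≈±1 x≉0)))) (zeroʳ x)

  χ-∏ : ∀ {x ε rs} → All (λ r → χ (x - r) ≈ ε) rs → χ ∏[ x - rs ] ≈ ε ^ length rs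
  χ-∏ []       = 1^n≈1 m
  χ-∏ (e ∷ es) = trans (χ-* _ _) (*-cong e (χ-∏ es))

  -- Zero is put in every class so that the solutions 0 and -a are counted twice.
  Class : Carrier → Carrier → Set ℓ
  Class ε x = x ≈ 0# ⊎ χ x ≈ ε

  Class? : ∀ ε → Decidable (Class ε)
  Class? ε x = _≟_ F x 0# ⊎-dec _≟_ F (χ x) ε

  class-cover : ∀ x → Class 1# x ⊎ Class (- 1#) x
  class-cover x with _≟_ F x 0#
  ... | yes x≈0 = inj₁ (inj₁ x≈0)
  ... | no x≉0  = [ inj₁ ∘ inj₂ , inj₂ ∘ inj₂ ]′ (χ≈±1 x≉0)

  -- Zero lies in both classes, so an element outside their intersection is nonzero and its class is
  -- its true character.
  class-exact : ∀ {ε x} → ¬ (Class 1# x × Class (- 1#) x) → Class ε x → χ x ≈ ε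
  class-exact ¬both (inj₁ x≈0) = contradiction (inj₁ x≈0 , inj₁ x≈0) ¬both
  class-exact ¬both (inj₂ χx≈ε) = χx≈ε

  all-exact : ∀ (g : Carrier → Carrier) {ε xs} →
              All (λ x → ¬ (Class 1# (g x) × Class (- 1#) (g x))) xs →
              All (λ x → Class ε (g x)) xs → All (λ x → χ (g x) ≈ ε) xs
  all-exact g ¬both cs = All.zipWith (λ (¬both , c) → class-exact ¬both c) (¬both , cs)

-- Counting the solutions of f (x + a) - f x = d.

module DifferenceCount
  {c ℓ : Level} {m j k s′ : ℕ} (m-odd : m ≡ suc (j ℕ.* 2)) (s-even : suc s′ ≡ k ℕ.* 2)
  (F : FiniteField c ℓ (suc (m ℕ.+ m))) where
  open QuadraticCharacter {j = j} m-odd F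
  open import Data.List.Relation.Unary.Unique.Setoid.Properties using () renaming (filter⁺ to unique-filter⁺)
  open import Relation.Binary.Reasoning.Setoid carrierSetoid

  module _ (a b d : Carrier) (a≉0 : a ≉ 0#) (b≉0 : b ≉ 0#)
           (1+b≉0 : 1# + b ≉ 0#) (-1+b≉0 : - 1# + b ≉ 0#) where

    s : ℕ
    s = suc s′

    f : Carrier → Carrier
    f x = x ^ s * (χ x + b)

    -- At x = 0 both sides vanish because s is positive, so any sign ε may be assigned to 0.
    f-class : ∀ {ε x} → Class ε x → f x ≈ (ε + b) * x ^ s
    f-class {ε} {x} (inj₁ x≈0) = begin
      x * x ^ s′ * (χ x + b)      ≈⟨ trans (*-congʳ xˢ≈0) (zeroˡ _) ⟩
      0#                          ≈⟨ trans (*-congˡ xˢ≈0) (zeroʳ _) ⟨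
      (ε + b) * (x * x ^ s′)      ∎
      where xˢ≈0 = trans (*-congʳ x≈0) (zeroˡ _)
    f-class {ε} {x} (inj₂ χx≈ε) = trans (*-congˡ (+-congʳ χx≈ε)) (*-comm _ _)

    R : Carrier → Carrier → Carrier → Carrier
    R ε η x = (ε + b) * (x + a) ^ s - (η + b) * x ^ s - d

    R-root : ∀ {ε η x} → f (x + a) - f x ≈ d → Class ε (x + a) → Class η x → R ε η x ≈ 0#
    R-root Δ≈d cε cη =
      x≈y⇒x∙y⁻¹≈ε (trans (sym (+-cong (f-class cε) (-‿cong (f-class cη)))) Δ≈d)

    -- The two copies of b cancel in the coefficient of degree s, and d does not reach it since s is
    -- positive.
    R-polynomial : ∀ ε η → IsPolynomial s (ε - η) (R ε η)
    R-polynomial ε η = polynomial-shift (- d) (polynomial-resp leading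
      (λ x → +-congˡ (sym (-‿distribˡ-* _ _)))
      (polynomial-+ (polynomial-scale (ε + b) (polynomial-[x+a]^ a s))
                    (polynomial-scale (- (η + b)) (polynomial-x^ s))))
      where
      leading : (ε + b) * 1# + - (η + b) * 1# ≈ ε - η
      leading = begin
        (ε + b) * 1# + - (η + b) * 1#   ≈⟨ +-cong (*-identityʳ _) (*-identityʳ _) ⟩
        (ε + b) + - (η + b)             ≈⟨ +-congˡ (-‿+-comm η b) ⟨
        (ε + b) + (- η + - b)
          ≈⟨ solve 4 (λ ε b η⁻ b⁻ → ε :+ b :+ (η⁻ :+ b⁻) := ε :+ η⁻ :+ (b :+ b⁻)) refl ε b (- η) (- b) ⟩
        (ε - η) + (b - b)               ≈⟨ +-congˡ (-‿inverseʳ b) ⟩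
        (ε - η) + 0#                    ≈⟨ +-identityʳ _ ⟩
        ε - η                           ∎

    -- The value is free of η, so polynomials sharing the sign ε agree at 0.
    R-at-0 : ∀ ε η → R ε η 0# ≈ (ε + b) * a ^ s - d
    R-at-0 ε η = +-congʳ (begin
      (ε + b) * (0# + a) ^ s - (η + b) * (0# * 0# ^ s′)
        ≈⟨ +-cong (*-congˡ (^-congˡ s (+-identityˡ a))) (-‿cong (trans (*-congˡ (zeroˡ _)) (zeroʳ _))) ⟩
      (ε + b) * a ^ s - 0#   ≈⟨ trans (+-congˡ -0#≈0#) (+-identityʳ _) ⟩
      (ε + b) * a ^ s        ∎)

    -- The value is free of ε, so polynomials sharing the sign η agree at - a. Evenness of s turns
    -- (- a)ˢ into aˢ.
    R-at--a : ∀ ε η → R ε η (- a) ≈ - ((η + b) * a ^ s) - d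
    R-at--a ε η = +-congʳ (begin
      (ε + b) * ((- a + a) * (- a + a) ^ s′) - (η + b) * (- a) ^ s
        ≈⟨ +-cong (trans (*-congˡ (trans (*-congʳ (-‿inverseˡ a)) (zeroˡ _))) (zeroʳ _))
                  (-‿cong (*-congˡ [-a]ˢ≈aˢ)) ⟩
      0# - (η + b) * a ^ s     ≈⟨ +-identityˡ _ ⟩
      - ((η + b) * a ^ s)      ∎)
      where
      [-a]ˢ≈aˢ : (- a) ^ s ≈ a ^ s
      [-a]ˢ≈aˢ = ≡.subst (λ t → (- a) ^ t ≈ a ^ t) (≡.sym s-even) ([-x]^2n≈x^2n a k)

    -- Zeros at 0 and at - a would express d both as (ε + b)aˢ and as -(η + b)aˢ.
    R-nonzero : ∀ ε η → (ε + b) + (η + b) ≉ 0# → ¬ (∀ x → R ε η x ≈ 0#)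
    R-nonzero ε η α+β≉0 R≈0 = x*y≉0 α+β≉0 (x^n≉0 s a≉0) (begin
      ((ε + b) + (η + b)) * a ^ s                ≈⟨ distribʳ _ _ _ ⟩
      (ε + b) * a ^ s + (η + b) * a ^ s          ≈⟨ +-congʳ αaˢ≈-βaˢ ⟩
      - ((η + b) * a ^ s) + (η + b) * a ^ s      ≈⟨ -‿inverseˡ _ ⟩
      0#                                         ∎)
      where
      αaˢ≈-βaˢ : (ε + b) * a ^ s ≈ - ((η + b) * a ^ s)
      αaˢ≈-βaˢ = trans (x∙y⁻¹≈ε⇒x≈y _ _ (trans (sym (R-at-0 ε η)) (R≈0 0#)))
                  (sym (x∙y⁻¹≈ε⇒x≈y _ _ (trans (sym (R-at--a ε η)) (R≈0 (- a)))))

    -- Equal signs cancel the top coefficient, lowering the bound to s - 1; nonvanishing rests on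
    -- 2(ε + b).
    R-bound-equal : ∀ ε → ε + b ≉ 0# → ∀ {rs} → Unique rs → All (λ r → R ε ε r ≈ 0#) rs → length rs ≤ s′
    R-bound-equal ε ε+b≉0 = root-bound (proj₂ (polynomial-drop (-‿inverseʳ ε) (R-polynomial ε ε)))
      (R-nonzero ε ε (x*y≉0 1+1≉0 ε+b≉0 ∘ trans double))
      where
      double : (1# + 1#) * (ε + b) ≈ (ε + b) + (ε + b)
      double = trans (distribʳ _ _ _) (+-cong (*-identityˡ _) (*-identityˡ _))

    -- The signs cancel in (ε + b) + (η + b), so nonvanishing rests on 2b.
    R-bound-distinct : ∀ ε η → ε + η ≈ 0# → ∀ {rs} → Unique rs → All (λ r → R ε η r ≈ 0#) rs → length rs ≤ s
    R-bound-distinct ε η ε+η≈0 = root-bound (R-polynomial ε η) (R-nonzero ε η (x*y≉0 1+1≉0 b≉0 ∘ trans (sym (begin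
      (ε + b) + (η + b)         ≈⟨ solve 3 (λ ε η b → ε :+ b :+ (η :+ b) := ε :+ η :+ (b :+ b)) refl ε η b ⟩
      (ε + η) + (b + b)         ≈⟨ +-congʳ ε+η≈0 ⟩
      0# + (b + b)              ≈⟨ +-identityˡ _ ⟩
      b + b                     ≈⟨ +-cong (*-identityˡ b) (*-identityˡ b) ⟨
      1# * b + 1# * b           ≈⟨ distribʳ _ _ _ ⟨
      (1# + 1#) * b             ∎))))

    -- Characters of completely split polynomials at 0 and at - a.

    χ[0-r] : ∀ {ε r} → χ r ≈ ε → χ (0# - r) ≈ - ε
    χ[0-r] {r = r} χr≈ε = trans (χ-cong (+-identityˡ _)) (trans (χ-neg r) (-‿cong χr≈ε))

    -- Since - a - r is -(r + a), the class of r + a governs the linear factors at - a, as the class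
    -- of r does at 0.
    χ[-a-r] : ∀ {ε r} → χ (r + a) ≈ ε → χ (- a - r) ≈ - ε
    χ[-a-r] {r = r} χ≈ε =
      trans (χ-cong (trans (-‿+-comm a r) (-‿cong (+-comm a r)))) (trans (χ-neg _) (-‿cong χ≈ε))

    -- When all linear factors at x share one character, only the top coefficient and the number of
    -- roots matter.
    χ-factorised : ∀ {n L p rs} → IsPolynomial n L p → Unique rs → All (λ r → p r ≈ 0#) rs → length rs ≡ n →
                   ∀ {x ε} → All (λ r → χ (x - r) ≈ ε) rs → χ (p x) ≈ χ L * ε ^ n
    χ-factorised {L = L} {p} {rs} h rs! roots ≡.refl {x} {ε} χs = begin
      χ (p x)                   ≈⟨ χ-cong (factorisation h rs! roots ≡.refl x) ⟩
      χ (L * ∏[ x - rs ])       ≈⟨ χ-* L _ ⟩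
      χ L * χ ∏[ x - rs ]       ≈⟨ *-congˡ (χ-∏ χs) ⟩
      χ L * ε ^ length rs       ∎

    -- The values R 1 1 0 = R 1 (-1) 0 and R 1 1 (-a) = R (-1) 1 (-a) have equal
    -- characters by factoring R 1 1, and opposite ones by factoring the other two.
    not-all-full : ∀ {xs ys zs} →
      Unique xs → All (λ r → R 1# 1# r ≈ 0#) xs → length xs ≡ s′ →
      All (λ r → χ (r + a) ≈ 1#) xs → All (λ r → χ r ≈ 1#) xs →
      Unique ys → All (λ r → R 1# (- 1#) r ≈ 0#) ys → length ys ≡ s →
      All (λ r → χ r ≈ - 1#) ys →
      Unique zs → All (λ r → R (- 1#) 1# r ≈ 0#) zs → length zs ≡ s →
      ¬ All (λ r → χ (r + a) ≈ - 1#) zs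
    not-all-full xs! Rxs ∣xs∣ χ[xs+a] χxs ys! Rys ∣ys∣ χys zs! Rzs ∣zs∣ χ[zs+a] =
      x*y≉0 1+1≉0 (x^n≉0 m 1+1≉0) (begin
        (1# + 1#) * χ₂            ≈⟨ trans (distribʳ _ _ _) (+-cong (*-identityˡ _) (*-identityˡ _)) ⟩
        χ₂ + χ₂                   ≈⟨ +-congʳ χ₂≈-χ₂ ⟩
        - χ₂ + χ₂                 ≈⟨ -‿inverseˡ χ₂ ⟩
        0#                        ∎)
      where
      χ₂ = χ (1# + 1#)
      dropped = polynomial-drop (-‿inverseʳ 1#) (R-polynomial 1# 1#)
      R₁₁ = proj₂ dropped
      y*[--1]^s≈y : ∀ y → y * (- - 1#) ^ s ≈ y
      y*[--1]^s≈y y = begin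
        y * (- - 1#) ^ s          ≈⟨ *-congˡ (^-congˡ s (-‿involutive 1#)) ⟩
        y * 1# ^ s                ≈⟨ *-congˡ (1^n≈1 s) ⟩
        y * 1#                    ≈⟨ *-identityʳ y ⟩
        y                         ∎
      χ₂≈-χ₂ : χ₂ ≈ - χ₂
      χ₂≈-χ₂ = begin
        χ (1# + 1#)               ≈⟨ χ-cong (+-congˡ (-‿involutive 1#)) ⟨
        χ (1# - - 1#)             ≈⟨ y*[--1]^s≈y _ ⟨
        χ (1# - - 1#) * (- - 1#) ^ s
          ≈⟨ χ-factorised (R-polynomial 1# (- 1#)) ys! Rys ∣ys∣ (All.map χ[0-r] χys) ⟨
        χ (R 1# (- 1#) 0#)        ≈⟨ χ-cong (trans (R-at-0 _ _) (sym (R-at-0 _ _))) ⟩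
        -- Every linear factor of `R 1 1` has character -1 at both points, so the unknown top
        -- coefficient and the parity of s′ do not affect the comparison.
        χ (R 1# 1# 0#)            ≈⟨ χ-factorised R₁₁ xs! Rxs ∣xs∣ (All.map χ[0-r] χxs) ⟩
        χ (proj₁ dropped) * (- 1#) ^ s′
          ≈⟨ χ-factorised R₁₁ xs! Rxs ∣xs∣ (All.map χ[-a-r] χ[xs+a]) ⟨
        χ (R 1# 1# (- a))         ≈⟨ χ-cong (trans (R-at--a _ _) (sym (R-at--a _ _))) ⟩
        χ (R (- 1#) 1# (- a))
          ≈⟨ χ-factorised (R-polynomial (- 1#) 1#) zs! Rzs ∣zs∣ (All.map χ[-a-r] χ[zs+a]) ⟩
        χ (- 1# - 1#) * (- - 1#) ^ s
          ≈⟨ y*[--1]^s≈y _ ⟩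
        χ (- 1# - 1#)             ≈⟨ χ-cong (-‿+-comm 1# 1#) ⟩
        χ (- (1# + 1#))           ≈⟨ χ-neg _ ⟩
        - χ (1# + 1#)             ∎

    -- S is split by the class of x and then by that of x + a. If its length reached 4s - 2, every
    -- bound along the way would be attained, the doubly counted elements would be excluded, and
    -- `not-all-full` would apply.
    solutions-bound : ∀ {S} → Unique S → All (λ x → f (x + a) - f x ≈ d) S →
                      length S < (s′ ℕ.+ s) ℕ.+ (s ℕ.+ s′)
    solutions-bound {S} S! Δ≈d = ℕ.≰⇒> λ full →
      let
        full-sides = ℕ.≤-trans full ∣S∣≤
        ∣S₊∣≡ = +-tightˡ S₊≤ S₋≤ full-sides
        ∣S₋∣≡ = +-tightʳ S₊≤ S₋≤ full-sides
        full₊ = ℕ.≤-trans (ℕ.≤-reflexive (≡.sym ∣S₊∣≡)) ∣S₊∣≤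
        full₋ = ℕ.≤-trans (ℕ.≤-reflexive (≡.sym ∣S₋∣≡)) ∣S₋∣≤
        -- Equality in the first splitting excludes x = 0.
        nz = tight-cover (Class? 1#) (Class? (- 1#)) (All.universal class-cover S)
               (ℕ.≤-trans (ℕ.+-mono-≤ S₊≤ S₋≤) full)
        -- Equality in the second excludes x = - a from S₊, the source of both lists whose
        -- characters at r + a are used.
        nz₊ = tight-cover (Shifted? 1#) (Shifted? (- 1#)) (All.universal (class-cover ∘ (_+ a)) S₊)
               (ℕ.≤-trans (ℕ.+-mono-≤ ∣₊₊∣≤ ∣₋₊∣≤) (ℕ.≤-reflexive (≡.sym ∣S₊∣≡)))
      in not-all-full
        (unique 1# 1#) (roots 1# 1#) (+-tightˡ ∣₊₊∣≤ ∣₋₊∣≤ full₊)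
        (all-exact (_+ a) (filter⁺ (Shifted? 1#) nz₊) (shifted 1# 1#))
        (all-exact (λ x → x) (filter⁺ (Shifted? 1#) (filter⁺ (Class? 1#) nz)) (unshifted 1# 1#))
        (unique 1# (- 1#)) (roots 1# (- 1#)) (+-tightˡ ∣₊₋∣≤ ∣₋₋∣≤ full₋)
        (all-exact (λ x → x) (filter⁺ (Shifted? 1#) (filter⁺ (Class? (- 1#)) nz)) (unshifted 1# (- 1#)))
        (unique (- 1#) 1#) (roots (- 1#) 1#) (+-tightʳ ∣₊₊∣≤ ∣₋₊∣≤ full₊)
        (all-exact (_+ a) (filter⁺ (Shifted? (- 1#)) nz₊) (shifted (- 1#) 1#))
      where
      Shifted? : ∀ ε → Decidable (λ x → Class ε (x + a))
      Shifted? ε x = Class? ε (x + a)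
      part : Carrier → Carrier → List Carrier
      part ε η = filter (Shifted? ε) (filter (Class? η) S)
      S₊ = filter (Class? 1#) S
      S₋ = filter (Class? (- 1#)) S
      unique : ∀ ε η → Unique (part ε η)
      unique ε η = unique-filter⁺ carrierSetoid (Shifted? ε) (unique-filter⁺ carrierSetoid (Class? η) S!)
      shifted : ∀ ε η → All (λ x → Class ε (x + a)) (part ε η)
      shifted ε η = all-filter (Shifted? ε) (filter (Class? η) S)
      unshifted : ∀ ε η → All (Class η) (part ε η)
      unshifted ε η = filter⁺ (Shifted? ε) (all-filter (Class? η) S)
      roots : ∀ ε η → All (λ x → R ε η x ≈ 0#) (part ε η)
      roots ε η = All.zipWith (λ (Δ , cε , cη) → R-root Δ cε cη)
        ( filter⁺ (Shifted? ε) (filter⁺ (Class? η) Δ≈d)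
        , All.zip (shifted ε η , unshifted ε η))
      ∣₊₊∣≤ = R-bound-equal 1# 1+b≉0 (unique 1# 1#) (roots 1# 1#)
      ∣₋₋∣≤ = R-bound-equal (- 1#) -1+b≉0 (unique (- 1#) (- 1#)) (roots (- 1#) (- 1#))
      ∣₊₋∣≤ = R-bound-distinct 1# (- 1#) (-‿inverseʳ 1#) (unique 1# (- 1#)) (roots 1# (- 1#))
      ∣₋₊∣≤ = R-bound-distinct (- 1#) 1# (-‿inverseˡ 1#) (unique (- 1#) 1#) (roots (- 1#) 1#)
      ∣S∣≤ = length-cover (Class? 1#) (Class? (- 1#)) (All.universal class-cover S)
      ∣S₊∣≤ = length-cover (Shifted? 1#) (Shifted? (- 1#)) (All.universal (class-cover ∘ (_+ a)) S₊)
      ∣S₋∣≤ = length-cover (Shifted? 1#) (Shifted? (- 1#)) (All.universal (class-cover ∘ (_+ a)) S₋)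
      S₊≤ : length S₊ ≤ s′ ℕ.+ s
      S₊≤ = ℕ.≤-trans ∣S₊∣≤ (ℕ.+-mono-≤ ∣₊₊∣≤ ∣₋₊∣≤)
      S₋≤ : length S₋ ≤ s ℕ.+ s′
      S₋≤ = ℕ.≤-trans ∣S₋∣≤ (ℕ.+-mono-≤ ∣₊₋∣≤ ∣₋₋∣≤)

-- From solution counts to the differential uniformity.

module _ {c ℓ : Level} {m j k s′ : ℕ} (m-odd : m ≡ suc (j ℕ.* 2)) (s-even : suc s′ ≡ k ℕ.* 2) where

  -- The equation for q is a hypothesis so that matching on it gives the field order the form suc (m
  -- + m). The bound is 4s - 3 for s = suc s′, written without subtraction.
  uniformity-bound : ∀ {q} → q ≡ suc (m ℕ.+ m) → (F : FiniteField c ℓ q) →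
    (b : FiniteField.Carrier F) → ¬ (FiniteField._≈_ F b (FiniteField.0# F)) →
    let f = mulᴾ F (powᴾ F (X F) (suc s′)) (addᴾ F (powᴾ F (X F) m) (constant F b)) in
    IsPermutationPolynomial F f →
    differentialUniformity F f ≤ s′ ℕ.+ s′ ℕ.+ (suc s′ ℕ.+ s′)
  uniformity-bound ≡.refl F b b≉0 (f-injective , _) =
    max≤v⁺ z≤n
      (cartesianProductWith⁺ (≡.setoid Carrier) (≡.setoid Carrier)
        (solutionCount F f) (nonzeroElements F) (elements F)
        λ {a} {d} a∈ _ → count a d (proj₂ (∈-filter⁻ (λ x → ¬? (_≟_ F x 0#)) {xs = elements F} a∈)))
    where
    open QuadraticCharacter {j = j} m-odd F
    open import Data.List.Relation.Unary.Unique.Setoid.Properties using () renaming (filter⁺ to unique-filter⁺)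
    open import Relation.Binary.Reasoning.Setoid carrierSetoid

    f : Poly F
    f = mulᴾ F (powᴾ F (X F) (suc s′)) (addᴾ F (powᴾ F (X F) m) (constant F b))

    eval-f : ∀ x → eval F f x ≈ x ^ suc s′ * (χ x + b)
    eval-f x = trans (eval-mulᴾ (powᴾ F (X F) (suc s′)) _ x) (*-cong (eval-powᴾ-X (suc s′) x)
      (trans (eval-addᴾ (powᴾ F (X F) m) _ x) (+-cong (eval-powᴾ-X m x) (eval-constant b x))))

    -- Otherwise f would take the value 0 at x as well as at 0, against injectivity. At x = 1 and x
    -- = -1 this excludes b = -1 and b = 1.
    χ+b≉0 : ∀ {x} → x ≉ 0# → χ x + b ≉ 0#
    χ+b≉0 {x} x≉0 χx+b≈0 = x≉0 (f-injective (begin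
      eval F f x                      ≈⟨ eval-f x ⟩
      x ^ suc s′ * (χ x + b)          ≈⟨ trans (*-congˡ χx+b≈0) (zeroʳ _) ⟩
      0#                              ≈⟨ trans (*-congʳ (zeroˡ _)) (zeroˡ _) ⟨
      0# ^ suc s′ * (χ 0# + b)        ≈⟨ eval-f 0# ⟨
      eval F f 0#                     ∎))

    -1≉0 : - 1# ≉ 0#
    -1≉0 -1≈0 = 1≉0 (trans (sym (-‿involutive 1#)) (trans (-‿cong -1≈0) -0#≈0#))

    count : ∀ a d → a ≉ 0# → solutionCount F f a d ≤ s′ ℕ.+ s′ ℕ.+ (suc s′ ℕ.+ s′)
    -- The strict bound 4s - 2 gives at most 4s - 3; rewriting s′ + suc s′ exposes the successor to
    -- be removed.
    count a d a≉0 = ℕ.≤-pred (ℕ.≤-trans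
      (solutions-bound a b d a≉0 b≉0
        (χ+b≉0 1≉0 ∘ trans (+-congʳ (1^n≈1 m)))
        (χ+b≉0 -1≉0 ∘ trans (+-congʳ (trans (χ-neg 1#) (-‿cong (1^n≈1 m)))))
        (unique-filter⁺ carrierSetoid Δ? elements-unique)
        (All.map (λ {x} → trans (+-cong (sym (eval-f (x + a))) (-‿cong (sym (eval-f x)))))
          (all-filter Δ? (elements F))))
      (ℕ.≤-reflexive (≡.cong (ℕ._+ (suc s′ ℕ.+ s′)) (ℕ.+-suc s′ s′))))
      where
      Δ? : Decidable (λ x → Δ F f a x ≈ d)
      Δ? x = _≟_ F (Δ F f a x) d
      open DifferenceCount {j = j} {k} m-odd s-even F

-- Arithmetic of q modulo 4 and of the final bound.

open import Data.Nat.Solver using (module +-*-Solver)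
open +-*-Solver using (solve; _:=_; _:+_; _:*_; con)

-- With t = q / 4 one has q = 4t + 3, hence (q - 1)/2 = 2t + 1.
half-odd : ∀ q → q % 4 ≡ 3 → (q ∸ 1) / 2 ≡ suc (q / 4 ℕ.* 2)
half-odd q q%4≡3 = begin
  (q ∸ 1) / 2
    ≡⟨ ≡.cong (λ t → (t ∸ 1) / 2) (≡.trans (m≡m%n+[m/n]*n q 4) (≡.cong (ℕ._+ q / 4 ℕ.* 4) q%4≡3)) ⟩
  (2 ℕ.+ q / 4 ℕ.* 4) / 2
    ≡⟨ ≡.cong (_/ 2) (solve 1 (λ t → con 2 :+ t :* con 4 := (con 1 :+ t :* con 2) :* con 2) ≡.refl (q / 4)) ⟩
  suc (q / 4 ℕ.* 2) ℕ.* 2 / 2       ≡⟨ m*n/n≡m (suc (q / 4 ℕ.* 2)) 2 ⟩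
  suc (q / 4 ℕ.* 2)                 ∎
  where open ≡.≡-Reasoning

odd-half : ∀ q → q % 4 ≡ 3 → q ≡ suc ((q ∸ 1) / 2 ℕ.+ (q ∸ 1) / 2)
odd-half q q%4≡3 = begin
  q                                              ≡⟨ m≡m%n+[m/n]*n q 4 ⟩
  q % 4 ℕ.+ q / 4 ℕ.* 4                          ≡⟨ ≡.cong (ℕ._+ q / 4 ℕ.* 4) q%4≡3 ⟩
  3 ℕ.+ q / 4 ℕ.* 4
    ≡⟨ solve 1 (λ t → con 3 :+ t :* con 4 := con 1 :+ ((con 1 :+ t :* con 2) :+ (con 1 :+ t :* con 2))) ≡.refl (q / 4) ⟩
  suc (suc (q / 4 ℕ.* 2) ℕ.+ suc (q / 4 ℕ.* 2))  ≡⟨ ≡.cong (λ t → suc (t ℕ.+ t)) (half-odd q q%4≡3) ⟨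
  suc ((q ∸ 1) / 2 ℕ.+ (q ∸ 1) / 2)              ∎
  where open ≡.≡-Reasoning

bound-value : ∀ t → 4 ℕ.* suc t ∸ 3 ≡ t ℕ.+ t ℕ.+ (suc t ℕ.+ t)
bound-value t = ≡.trans
  (≡.cong (_∸ 3) (solve 1 (λ t → con 4 :* (con 1 :+ t) := con 3 :+ (t :+ t :+ ((con 1 :+ t) :+ t))) ≡.refl t))
  (ℕ.m+n∸m≡n 3 _)

open import Data.Nat.Base using (_*_)

theorem1p2 : ∀ {c ℓ : Level} (q : ℕ) → IsPrimePower q → q % 4 ≡ 3 →
    (F : FiniteField c ℓ q) →
    (s : ℕ) → 1 ≤ s → 2 ∣ s →
    (b : FiniteField.Carrier F) → ¬ (FiniteField._≈_ F b (FiniteField.0# F)) →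
    let f = mulᴾ F (powᴾ F (X F) s) (addᴾ F (powᴾ F (X F) ((q ∸ 1) / 2)) (constant F b)) in
    IsPermutationPolynomial F f →
    differentialUniformity F f ≤ 4 * s ∸ 3
theorem1p2 q _ q%4≡3 F (suc s′) _ (divides k s-even) b b≉0 f-perm =
  ℕ.≤-trans
    -- Here `q / 4` witnesses the oddness of (q - 1)/2, and k is half of s.
    (uniformity-bound {j = q / 4} {k} (half-odd q q%4≡3) s-even (odd-half q q%4≡3) F b b≉0 f-perm)
    (ℕ.≤-reflexive (≡.sym (bound-value s′)))
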